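{- Let $W$ be a set and let $\mathbf{T}=\langle T,\sqcap,\sqcup,1,0,\rightarrow\rangle$ be a complete Heyting algebra over a non-empty set $T$, with twisted structure $\mathcal{T}$. Then the algebra of paraconsistent sets $\mathbf{Set_P}(\mathcal{T})=\langle (T\times T)^W,(T\times T)^W,+,\cdot,{}^\star,{}^-,\oslash,\varUpsilon\rangle$ is a paraconsistent Kleene algebra with tests (PKAT).
   Context: A complete Heyting algebra is a bounded lattice with greatest element $1$ and least element $0$, in which every subset has a supremum and an infimum, with an operation $\rightarrow$ satisfying $a\sqcap b\le c$ iff $b\le a\rightarrow c$. Twisted structure: the twisted structure $\mathcal{T}$ of $\mathbf{T}$ has carrier $T\times T$, with operations $\sim(a,b)=(b,a)$, $(a,a')\Cap(b,b')=(a\sqcap b,\,a'\sqcup b')$, $(a,a')\Cup(b,b')=(a\sqcup b,\,a'\sqcap b')$, constants $(0,1)$ and $(1,0)$, and order $(a,a')\preccurlyeq(b,b')$ iff $a\le b$ and $a'\ge b'$. For this order $T\times T$ is a complete lattice with join $\Cup$ and meet $\Cap$; the join of a family is $\bigvee_{i}(a_i,a'_i)=(\bigsqcup_i a_i,\ \inf_i a'_i)$. Paraconsistent sets: $(T\times T)^W$ is the set of functions $W\to T\times T$; it serves both as the set of programs and as the set of tests. For $\varphi,\psi\in(T\times T)^W$ and $w\in W$: $\oslash(w)=(0,1)$; $\varUpsilon(w)=(1,0)$; $\overline{\varphi}(w)=\ \sim\varphi(w)$; $(\varphi+\psi)(w)=\varphi(w)\Cup\psi(w)$; $(\varphi\cdot\psi)(w)=\varphi(w)\Cap\psi(w)$;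 $\varphi^\star(w)=\bigvee_{n\ge 0}\varphi^n(w)$, where $\varphi^0=\varUpsilon$ and $\varphi^{n+1}=\varphi\cdot\varphi^n$. The constant $\oslash$ plays the role of $0$ and $\varUpsilon$ the role of $1$. A Kleene algebra (KA) is a structure $(K,+,\cdot,{}^\star,0,1)$ such that for all $p,q,r\in K$: $p+(q+r)=(p+q)+r$; $p+q=q+p$; $p+0=p$; $p+p=p$; $p\cdot(q\cdot r)=(p\cdot q)\cdot r$; $1\cdot p=p\cdot 1=p$; $p\cdot(q+r)=p\cdot q+p\cdot r$; $(p+q)\cdot r=p\cdot r+q\cdot r$; $0\cdot p=p\cdot 0=0$; $1+p\cdot p^\star=p^\star$; $1+p^\star\cdot p=p^\star$; $p\cdot r\le r$ implies $p^\star\cdot r\le r$; $r\cdot p\le r$ implies $r\cdot p^\star\le r$. Here $p\le q$ means $p+q=q$. A paraconsistent Kleene algebra with tests (PKAT) is a structure $(K,T_0,+,\cdot,{}^\star,{}^-,0,1)$ such that $(K,+,\cdot,{}^\star,0,1)$ is a Kleene algebra, $T_0\subseteq K$ contains $0,1$ and is closed under $+$, $\cdot$ (the restrictions of the operations of $K$) and under a unary operation ${}^-:T_0\to T_0$, and for all $\alpha,\beta,\gamma\in T_0$: $\alpha+(\beta\cdot\gamma)=(\alpha+\beta)\cdot(\alpha+\gamma)$; $(\alpha\cdot\beta)+\gamma=(\alpha+\gamma)\cdot(\beta+\gamma)$; $\alpha\cdot\beta=\beta\cdot\alpha$; $\alpha\cdot\alpha=\alpha$; $\overline{\overline{\alpha}}=\alpha$;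 $\alpha+1=1$.
   Formalization: The printed definition (a,a')⋓(b,b') = (a⊓b, a'⊓b') makes p+0=p fail and is not the join; the formal statement uses the join (a⊔b, a'⊓b') instead, as the paper's description of ⋓ as join requires. -}

module Defs where

open import Algebra.Core using (Op₁; Op₂)
open import Algebra.Definitions using (Congruent₁)
open import Algebra.Structures using (IsIdempotentSemiring)
open import Data.Nat.Base using (ℕ; zero; suc)
open import Data.Product.Base using (_×_; _,_; ∃; proj₁; proj₂; swap)
open import Data.Product.Relation.Binary.Pointwise.NonDependent using (Pointwise)
open import Data.Unit.Base using (tt)
open import Function.Base using (_∘_; flip; const)
open import Level using (Level; _⊔_; Lift; lower) renaming (suc to lsuc)
open import Relation.Binary.Core using (Rel)
open import Relation.Binary.Definitions using (_Respects_)
open import Relation.Binary.Lattice.Bundles using (HeytingAlgebra)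
open import Relation.Unary using (Pred; U)

module _ {a ℓ} {A : Set a} (_≤_ : Rel A ℓ) where

  UpperBound : ∀ {p} → Pred A p → Pred A (a ⊔ ℓ ⊔ p)
  UpperBound P u = ∀ {x} → P x → x ≤ u

  IsSupremum : ∀ {p} → Pred A p → Pred A (a ⊔ ℓ ⊔ p)
  IsSupremum P s = UpperBound P s × (∀ {u} → UpperBound P u → s ≤ u)

IsInfimum : ∀ {a ℓ p} {A : Set a} → Rel A ℓ → Pred A p → Pred A (a ⊔ ℓ ⊔ p)
IsInfimum _≤_ = IsSupremum (flip _≤_)

-- Subsets are predicates, so completeness is relative to a universe level.
-- It is chosen of the form ℓ₁ ⊔ p so that the range { x | ∃ i, f i ≈ x } of a
-- family indexed by I : Set p is one of them; p is arbitrary.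
record CompleteHeytingAlgebra (c ℓ₁ ℓ₂ p : Level)
         : Set (lsuc (c ⊔ ℓ₁ ⊔ ℓ₂ ⊔ p)) where
  field
    heytingAlgebra : HeytingAlgebra c ℓ₁ ℓ₂

  open HeytingAlgebra heytingAlgebra public

  field
    supremumOf : (P : Pred Carrier (ℓ₁ ⊔ p)) → ∃ (IsSupremum _≤_ P)
    infimumOf  : (P : Pred Carrier (ℓ₁ ⊔ p)) → ∃ (IsInfimum _≤_ P)

  range : {I : Set p} → (I → Carrier) → Pred Carrier (ℓ₁ ⊔ p)
  range f x = ∃ λ i → f i ≈ x

  ⨆ ⨅ : {I : Set p} → (I → Carrier) → Carrier
  ⨆ f = proj₁ (supremumOf (range f))
  ⨅ f = proj₁ (infimumOf (range f))

module Twisted {c ℓ₁ ℓ₂ p} (𝐓 : CompleteHeytingAlgebra c ℓ₁ ℓ₂ p) where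
  open CompleteHeytingAlgebra 𝐓

  infix  4 _≈ₜ_ _≼_
  infixr 6 _⋓_
  infixr 7 _⋒_

  T×T : Set c
  T×T = Carrier × Carrier

  _≈ₜ_ : Rel T×T ℓ₁
  _≈ₜ_ = Pointwise _≈_ _≈_

  _≼_ : Rel T×T ℓ₂
  _≼_ = Pointwise _≤_ (flip _≤_)

  ∼_ : Op₁ T×T
  ∼_ = swap

  _⋒_ _⋓_ : Op₂ T×T
  (a , a′) ⋒ (b , b′) = a ∧ b , a′ ∨ b′
  (a , a′) ⋓ (b , b′) = a ∨ b , a′ ∧ b′

  ⊥ₜ ⊤ₜ : T×T
  ⊥ₜ = ⊥ , ⊤
  ⊤ₜ = ⊤ , ⊥

  ⋁ : {I : Set p} → (I → T×T) → T×T
  ⋁ f = ⨆ (proj₁ ∘ f) , ⨅ (proj₂ ∘ f)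

  ⋁-isSupremum : {I : Set p} (f : I → T×T) →
                 IsSupremum _≼_ (λ x → ∃ λ i → f i ≈ₜ x) (⋁ f)
  ⋁-isSupremum f
    with _ , ub , least    ← supremumOf (range (proj₁ ∘ f))
       | _ , lb , greatest ← infimumOf (range (proj₂ ∘ f))
    = (λ (i , e , e′) → ub (i , e) , lb (i , e′))
    , λ bound →
        least    (λ (i , e) → trans (reflexive (Eq.sym e))
                                    (proj₁ (bound (i , Eq.refl , Eq.refl))))
      , greatest (λ (i , e) → trans (proj₂ (bound (i , Eq.refl , Eq.refl)))
                                    (reflexive e))

module ParaconsistentSets {c ℓ₁ ℓ₂ p w}
         (W : Set w) (𝐓 : CompleteHeytingAlgebra c ℓ₁ ℓ₂ p) where
  open Twisted 𝐓

  infix  4 _≋_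
  infixl 6 _+_
  infixl 7 _·_
  infixr 8 _^_
  infix  9 _⋆

  PSet : Set (c ⊔ w)
  PSet = W → T×T

  _≋_ : Rel PSet (ℓ₁ ⊔ w)
  φ ≋ ψ = ∀ x → φ x ≈ₜ ψ x

  ⊘ Υ : PSet
  ⊘ = const ⊥ₜ
  Υ = const ⊤ₜ

  -- Every paraconsistent set is a test.
  ⁻_ : Op₁ (∃ (U {A = PSet}))
  ⁻ (φ , _) = (λ x → ∼ φ x) , tt

  _+_ _·_ : Op₂ PSet
  (φ + ψ) x = φ x ⋓ ψ x
  (φ · ψ) x = φ x ⋒ ψ x

  _^_ : PSet → ℕ → PSet
  φ ^ zero  = Υ
  φ ^ suc n = φ · φ ^ n

  _⋆ : Op₁ PSet
  (φ ⋆) x = ⋁ {I = Lift p ℕ} (λ n → (φ ^ lower n) x)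

module _ {k ℓ} {K : Set k} (_≈_ : Rel K ℓ) where

  -- Not the library's IsKleeneAlgebra: its star-destructive laws conclude
  -- with an equation (a ⋆ ∙ b ≈ x) where the induction rules of Kleene
  -- algebra have an inequality.
  record IsKA (_+_ _·_ : Op₂ K) (_⋆ : Op₁ K) (0# 1# : K) : Set (k ⊔ ℓ) where
    infix 4 _≤_
    _≤_ : Rel K ℓ
    p ≤ q = (p + q) ≈ q

    field
      isIdempotentSemiring : IsIdempotentSemiring _≈_ _+_ _·_ 0# 1#
      ⋆-cong               : Congruent₁ _≈_ _⋆
      ⋆-unfoldˡ            : ∀ p → (1# + (p · (p ⋆))) ≈ (p ⋆)
      ⋆-unfoldʳ            : ∀ p → (1# + ((p ⋆) · p)) ≈ (p ⋆)
      ⋆-inductˡ            : ∀ p r → (p · r) ≤ r → ((p ⋆) · r) ≤ r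
      ⋆-inductʳ            : ∀ p r → (r · p) ≤ r → (r · (p ⋆)) ≤ r

  record IsPKAT {t} (T₀ : Pred K t) (_+_ _·_ : Op₂ K) (_⋆ : Op₁ K)
                (⁻_ : Op₁ (∃ T₀)) (0# 1# : K) : Set (k ⊔ ℓ ⊔ t) where
    field
      isKA    : IsKA _+_ _·_ _⋆ 0# 1#

      T₀-resp : T₀ Respects _≈_
      0∈T₀    : T₀ 0#
      1∈T₀    : T₀ 1#
      +-closed : ∀ {α β} → T₀ α → T₀ β → T₀ (α + β)
      ·-closed : ∀ {α β} → T₀ α → T₀ β → T₀ (α · β)
      ⁻-cong  : ∀ (α β : ∃ T₀) → proj₁ α ≈ proj₁ β →
                proj₁ (⁻ α) ≈ proj₁ (⁻ β)

      +-distribˡ-· : ∀ {α β γ} → T₀ α → T₀ β → T₀ γ →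
                     (α + (β · γ)) ≈ ((α + β) · (α + γ))
      +-distribʳ-· : ∀ {α β γ} → T₀ α → T₀ β → T₀ γ →
                     ((α · β) + γ) ≈ ((α + γ) · (β + γ))
      ·-comm       : ∀ {α β} → T₀ α → T₀ β → (α · β) ≈ (β · α)
      ·-idem       : ∀ {α} → T₀ α → (α · α) ≈ α
      ⁻-involutive : ∀ (α : ∃ T₀) → proj₁ (⁻ (⁻ α)) ≈ proj₁ α
      +-zeroʳ      : ∀ {α} → T₀ α → (α + 1#) ≈ 1#

{-# OPTIONS --safe #-}
-- The twisted structure is the product of the bounded distributive lattice T
-- with its order dual, so (+, ·, ⊘, Υ) is a pointwise product of two
-- idempotent semirings, and so is its dual (·, +, Υ, ⊘); together they give
-- every law without a star.  Since φ⁰ = Υ is the top element, φ⋆ = Υ for all φ,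
-- and the star laws hold as in any idempotent semiring with greatest element 1.
module Submission where

open import Defs
open import Algebra.Bundles using (IdempotentSemiring)
import Algebra.Construct.DirectProduct as DirectProduct
import Algebra.Construct.Pointwise as Pointwise
open import Algebra.Core using (Op₁; Op₂)
open import Algebra.Definitions using (Identity; Zero; LeftZero)
open import Algebra.Lattice.Bundles using (DistributiveLattice)
import Algebra.Lattice.Properties.DistributiveLattice as DistributiveLatticeProperties
open import Algebra.Structures using (IsIdempotentSemiring)
open import Data.Product.Base using (_,_; proj₁; swap)
open import Data.Unit.Base using (tt)
open import Level using (Level; lift; lower)
open import Relation.Binary.Core using (Rel)
open import Relation.Binary.Lattice.Bundles using (HeytingAlgebra)
import Relation.Binary.Lattice.Properties.BoundedJoinSemilattice as BoundedJoin
import Relation.Binary.Lattice.Properties.BoundedMeetSemilattice as BoundedMeet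
import Relation.Binary.Lattice.Properties.DistributiveLattice as OrderDistributive
import Relation.Binary.Lattice.Properties.HeytingAlgebra as Heyting
import Relation.Binary.Lattice.Properties.Lattice as OrderLattice
import Relation.Binary.Reasoning.Setoid as ≈-Reasoning
open import Relation.Unary using (U)

module _ {c ℓ} (L : DistributiveLattice c ℓ) where
  open DistributiveLattice L
  open DistributiveLatticeProperties L using (∨-idem)

  -- Absorption: with `x` rewritten as `⊥ ∨ x`, the meet `⊥ ∧ (⊥ ∨ x)` collapses to `⊥`.
  identity⇒zero : ∀ {⊥} → Identity _≈_ ⊥ _∨_ → Zero _≈_ ⊥ _∧_
  identity⇒zero {⊥} (identityˡ , _) = zeroˡ , λ x → trans (∧-comm x ⊥) (zeroˡ x)
    where
    zeroˡ : LeftZero _≈_ ⊥ _∧_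
    zeroˡ x = trans (∧-congˡ (sym (identityˡ x))) (∧-absorbs-∨ ⊥ x)

  -- The units are parameters, tied to the lattice only by their identity laws, so that the
  -- construction also applies to the order dual, where they trade places.
  ∨-∧-idempotentSemiring : ∀ {⊥ ⊤} → Identity _≈_ ⊥ _∨_ → Identity _≈_ ⊤ _∧_ →
                           IdempotentSemiring c ℓ
  ∨-∧-idempotentSemiring {⊥} {⊤} ∨-identity ∧-identity = record
    { 0# = ⊥
    ; 1# = ⊤
    ; isIdempotentSemiring = record
      { isSemiring = record
        { isSemiringWithoutAnnihilatingZero = record
          { +-isCommutativeMonoid = record
            { isMonoid = record
              { isSemigroup = record
                { isMagma = record
                  { isEquivalence = isEquivalence
                  ; ∙-cong = ∨-cong
                  }
                ; assoc = ∨-assoc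
                }
              ; identity = ∨-identity
              }
            ; comm = ∨-comm
            }
          ; *-cong = ∧-cong
          ; *-assoc = ∧-assoc
          ; *-identity = ∧-identity
          ; distrib = ∧-distrib-∨
          }
        ; zero = identity⇒zero ∨-identity
        }
      ; +-idem = ∨-idem
      }
    }

module _ {c ℓ₁ ℓ₂} (H : HeytingAlgebra c ℓ₁ ℓ₂) where
  open HeytingAlgebra H
  open Heyting H using (distributiveLattice)

  -- Distributivity comes from the implication: meeting with a fixed element has a right adjoint and
  -- so preserves binary joins.
  algDistributiveLattice : DistributiveLattice c ℓ₁
  algDistributiveLattice = record
    { isDistributiveLattice = record
      { isLattice   = OrderLattice.isAlgLattice lattice
      ; ∨-distrib-∧ = OrderDistributive.∨-distrib-∧ distributiveLattice
      ; ∧-distrib-∨ = OrderDistributive.∧-distrib-∨ distributiveLattice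
      }
    }

  joinSemiring meetSemiring : IdempotentSemiring c ℓ₁
  joinSemiring = ∨-∧-idempotentSemiring algDistributiveLattice
    (BoundedJoin.identity boundedJoinSemilattice)
    (BoundedMeet.identity boundedMeetSemilattice)
  meetSemiring = ∨-∧-idempotentSemiring
    (DistributiveLatticeProperties.∧-∨-distributiveLattice algDistributiveLattice)
    (BoundedMeet.identity boundedMeetSemilattice)
    (BoundedJoin.identity boundedJoinSemilattice)

module _ {k ℓ} {K : Set k} {_≈_ : Rel K ℓ}
         {_+_ _·_ : Op₂ K} {_⋆ : Op₁ K} {0# 1# : K} where

  -- Both sides of each unfolding law collapse to `1#`. In the induction rules the star acts as a
  -- unit, which leaves `r + r ≈ r`.
  ⋆≈1⇒isKA : IsIdempotentSemiring _≈_ _+_ _·_ 0# 1# → LeftZero _≈_ 1# _+_ →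
             (∀ p → (p ⋆) ≈ 1#) → IsKA _≈_ _+_ _·_ _⋆ 0# 1#
  ⋆≈1⇒isKA isIdempotentSemiring 1+p≈1 ⋆≈1 = record
    { isIdempotentSemiring = isIdempotentSemiring
    ; ⋆-cong    = λ {p} {q} _ → trans (⋆≈1 p) (sym (⋆≈1 q))
    ; ⋆-unfoldˡ = λ p → trans (1+p≈1 _) (sym (⋆≈1 p))
    ; ⋆-unfoldʳ = λ p → trans (1+p≈1 _) (sym (⋆≈1 p))
    ; ⋆-inductˡ = λ p r _ → begin
        ((p ⋆) · r) + r  ≈⟨ +-congʳ (*-congʳ (⋆≈1 p)) ⟩
        (1# · r) + r     ≈⟨ +-congʳ (*-identityˡ r) ⟩
        r + r            ≈⟨ +-idem r ⟩
        r                ∎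
    ; ⋆-inductʳ = λ p r _ → begin
        (r · (p ⋆)) + r  ≈⟨ +-congʳ (*-congˡ (⋆≈1 p)) ⟩
        (r · 1#) + r     ≈⟨ +-congʳ (*-identityʳ r) ⟩
        r + r            ≈⟨ +-idem r ⟩
        r                ∎
    }
    where
    open IsIdempotentSemiring isIdempotentSemiring
    open ≈-Reasoning setoid

module _ {c ℓ₁ ℓ₂ p w} (W : Set w) (𝐓 : CompleteHeytingAlgebra c ℓ₁ ℓ₂ p) where
  open CompleteHeytingAlgebra 𝐓
    using (heytingAlgebra; antisym; maximum; minimum; module Eq)
  open Twisted 𝐓
  open ParaconsistentSets W 𝐓

  -- The order is reversed in the second coordinate, so the second factor is `meetSemiring`.
  +-·-isIdempotentSemiring : IsIdempotentSemiring _≋_ _+_ _·_ ⊘ Υ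
  +-·-isIdempotentSemiring = Pointwise.isIdempotentSemiring W
    (IdempotentSemiring.isIdempotentSemiring
      (DirectProduct.idempotentSemiring (joinSemiring heytingAlgebra)
                                        (meetSemiring heytingAlgebra)))

  -- Source of the test axioms: distributivity of `_+_` over `_·_`, and commutativity and
  -- idempotence of `_·_`, are semiring laws here.
  ·-+-isIdempotentSemiring : IsIdempotentSemiring _≋_ _·_ _+_ Υ ⊘
  ·-+-isIdempotentSemiring = Pointwise.isIdempotentSemiring W
    (IdempotentSemiring.isIdempotentSemiring
      (DirectProduct.idempotentSemiring (meetSemiring heytingAlgebra)
                                        (joinSemiring heytingAlgebra)))

  ⋆≋Υ : ∀ φ → φ ⋆ ≋ Υ
  ⋆≋Υ φ x
    -- Index 0 selects `φ ^ 0`, whose value is `(⊤ , ⊥)`. As a member of the family it lies below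
    -- the join, which bounds the first coordinate from below by `⊤` and the second from above by
    -- `⊥`.
    with ⊤≤ , ≤⊥ ← proj₁ (⋁-isSupremum (λ n → (φ ^ lower n) x))
                         (lift 0 , Eq.refl , Eq.refl)
    = antisym (maximum _) ⊤≤ , antisym ≤⊥ (minimum _)

theorem2 : ∀ {c ℓ₁ ℓ₂ p w : Level} (W : Set w) (𝐓 : CompleteHeytingAlgebra c ℓ₁ ℓ₂ p) →
    let open ParaconsistentSets W 𝐓 in
    IsPKAT _≋_ U _+_ _·_ _⋆ ⁻_ ⊘ Υ
theorem2 W 𝐓 = record
  -- The dual semiring has zero `Υ` and product `_+_`, so `Dual.zeroˡ` reads `Υ + φ ≋ Υ`.
  { isKA         = ⋆≈1⇒isKA (+-·-isIdempotentSemiring W 𝐓) Dual.zeroˡ (⋆≋Υ W 𝐓)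
  ; T₀-resp      = λ _ _ → tt
  ; 0∈T₀         = tt
  ; 1∈T₀         = tt
  ; +-closed     = λ _ _ → tt
  ; ·-closed     = λ _ _ → tt
  ; ⁻-cong       = λ _ _ φ≋ψ x → swap (φ≋ψ x)
  ; +-distribˡ-· = λ _ _ _ → Dual.distribˡ _ _ _
  ; +-distribʳ-· = λ _ _ _ → Dual.distribʳ _ _ _
  ; ·-comm       = λ _ _ → Dual.+-comm _ _
  ; ·-idem       = λ _ → Dual.+-idem _
  -- Swapping a pair twice gives it back definitionally.
  ; ⁻-involutive = λ _ _ → Eq.refl , Eq.refl
  ; +-zeroʳ      = λ _ → Dual.zeroʳ _
  }
  where
  module Dual = IsIdempotentSemiring (·-+-isIdempotentSemiring W 𝐓)
  open CompleteHeytingAlgebra 𝐓 using (module Eq)
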